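{- Let $\mathcal K$ be an abstract Krivine structure. For all $a,b\in\mathcal P_\perp(\Pi)$, $$\overline{a\circ_\bullet b}=\overline{\bigcup\{c\in\mathcal P_\perp(\Pi): b\to_\perp c\subseteq a\}},$$ i.e. $\overline{a\circ_\bullet b}=a\,\sharp\,b$, where $a\,\sharp\,b$ is the infimum of $\{c\in\mathcal P_\perp(\Pi): a\le b\to_\perp c\}$ in $\mathcal P_\perp(\Pi)$ ordered by $a\le b\iff a\supseteq b$.
   Context: An abstract Krivine structure $\mathcal K$ consists of sets $\Lambda,\Pi$, a relation $\perp\subseteq\Lambda\times\Pi$, a map $\mathrm{push}$ written $t\cdot\pi$ (associating to the right), an application $ts$ on $\Lambda$, a subset $\mathrm{QP}\subseteq\Lambda$ closed under application, and $\mathsf K,\mathsf S\in\mathrm{QP}$ with: $t\perp s\cdot\pi\Rightarrow ts\perp\pi$; $t\perp\pi\Rightarrow\mathsf K\perp t\cdot s\cdot\pi$; $tu(su)\perp\pi\Rightarrow\mathsf S\perp t\cdot s\cdot u\cdot\pi$. Polars: $L^\perp=\{\pi:\forall t\in L,\ t\perp\pi\}$, ${}^\perp P=\{t:\forall\pi\in P,\ t\perp\pi\}$; $\overline P=({}^\perp P)^\perp$; $\mathcal P_\perp(\Pi)=\{P:\overline P=P\}$. For $P,Q\subseteq\Pi$: $P\to_\perp Q=\overline{\{t\cdot\pi:t\in{}^\perp P,\pi\in Q\}}$ and $P\circ_\bullet Q=\{\pi\in\Pi: t\cdot\pi'\in P\ \forall t\in{}^\perp Q,\ \pi'\in\overline{\{\pi\}}\}$.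 -}

module Defs where

open import Data.Product using (_×_; _,_; proj₂; ∃₂)
open import Function using (_∘_)
open import Level using (Level; suc; _⊔_)
open import Relation.Binary using (REL; Poset)
open import Relation.Binary.PropositionalEquality using (_≡_)
open import Relation.Unary using (Pred; _∈_; _⊆_; _⊇_; _≐_; ｛_｝)
open import Relation.Unary.Properties using (≐-refl; ≐-sym; ≐-trans)

private
  variable
    ℓ p q : Level

IsInfimum : ∀ {c ℓ₁ ℓ₂ s} (P : Poset c ℓ₁ ℓ₂) →
            Pred (Poset.Carrier P) s → Pred (Poset.Carrier P) (c ⊔ ℓ₂ ⊔ s)
IsInfimum P S x = (∀ y → y ∈ S → x ≤ y) × (∀ z → (∀ y → y ∈ S → z ≤ y) → z ≤ x)
  where open Poset P

record AbstractKrivineStructure (ℓ : Level) : Set (suc ℓ) where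
  infix  4 _⊥_
  infixr 5 _·_
  infixl 7 _∙_
  field
    Λ   : Set ℓ
    Π   : Set ℓ
    _⊥_ : REL Λ Π ℓ
    _·_ : Λ → Π → Π
    _∙_ : Λ → Λ → Λ
    QP  : Pred Λ ℓ
    𝖪   : Λ
    𝖲   : Λ

    QP-∙ : ∀ {t s} → t ∈ QP → s ∈ QP → t ∙ s ∈ QP
    𝖪∈QP : 𝖪 ∈ QP
    𝖲∈QP : 𝖲 ∈ QP

    ⊥-push : ∀ {t s π} → t ⊥ s · π → t ∙ s ⊥ π
    ⊥-𝖪    : ∀ {t s π} → t ⊥ π → 𝖪 ⊥ t · s · π
    ⊥-𝖲    : ∀ {t s u π} → t ∙ u ∙ (s ∙ u) ⊥ π → 𝖲 ⊥ t · s · u · π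

-- A subset is a predicate, and equality of subsets is extensional (_≐_).
-- Polars and closure accept predicates of any level, because a union indexed
-- by all closed subsets lives one level above those subsets.
module Polarity (𝒦 : AbstractKrivineStructure ℓ) where
  open AbstractKrivineStructure 𝒦

  infix  9 _^⊥ ⊥^_
  infixr 6 _→⊥_ _⇒⊥_
  infixl 7 _∘•_
  infix  4 _≤_

  _^⊥ : Pred Λ p → Pred Π (ℓ ⊔ p)
  L ^⊥ = λ π → ∀ t → t ∈ L → t ⊥ π

  ⊥^_ : Pred Π p → Pred Λ (ℓ ⊔ p)
  ⊥^ P = λ t → ∀ π → π ∈ P → t ⊥ π

  cl : Pred Π p → Pred Π (ℓ ⊔ p)
  cl P = (⊥^ P) ^⊥

  _→⊥_ : Pred Π p → Pred Π q → Pred Π (ℓ ⊔ p ⊔ q)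
  P →⊥ Q = cl (λ ρ → ∃₂ λ t π → t ∈ ⊥^ P × π ∈ Q × ρ ≡ t · π)

  _∘•_ : Pred Π p → Pred Π q → Pred Π (ℓ ⊔ p ⊔ q)
  P ∘• Q = λ π → ∀ t π′ → t ∈ ⊥^ Q → π′ ∈ cl ｛ π ｝ → t · π′ ∈ P

  record 𝒫⊥ : Set (suc ℓ) where
    constructor mk𝒫⊥
    field
      ∣_∣    : Pred Π ℓ
      closed : cl ∣_∣ ≐ ∣_∣

  open 𝒫⊥ public

  cl-idem : (P : Pred Π p) → cl (cl P) ≐ cl P
  cl-idem P = (λ π∈ t t∈ → π∈ t (λ ρ ρ∈ → ρ∈ t t∈)) , (λ π∈ t t∈ → t∈ _ π∈)

  Cl : Pred Π ℓ → 𝒫⊥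
  Cl P = mk𝒫⊥ (cl P) (cl-idem P)

  _⇒⊥_ : 𝒫⊥ → 𝒫⊥ → 𝒫⊥
  a ⇒⊥ b = mk𝒫⊥ (∣ a ∣ →⊥ ∣ b ∣) (cl-idem _)

  _≤_ : 𝒫⊥ → 𝒫⊥ → Set ℓ
  a ≤ b = ∣ a ∣ ⊇ ∣ b ∣

  𝒫⊥-poset : Poset (suc ℓ) ℓ ℓ
  𝒫⊥-poset = record
    { Carrier = 𝒫⊥
    ; _≈_ = λ a b → ∣ a ∣ ≐ ∣ b ∣
    ; _≤_ = _≤_
    ; isPartialOrder = record
      { isPreorder = record
        { isEquivalence = record { refl = ≐-refl ; sym = ≐-sym ; trans = ≐-trans }
        ; reflexive = proj₂
        ; trans = λ a⊇b b⊇c → a⊇b ∘ b⊇c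
        }
      ; antisym = λ a⊇b b⊇a → b⊇a , a⊇b
      }
    }

  -- d is a ♯ b.  This is a relation, not an operation, because the closure of
  -- the defining union has level suc ℓ and so is not itself a term of 𝒫⊥.
  -- Infima are unique up to _≐_, by antisymmetry.
  _Is_♯_ : 𝒫⊥ → 𝒫⊥ → 𝒫⊥ → Set (suc ℓ)
  d Is a ♯ b = IsInfimum 𝒫⊥-poset (λ c → a ≤ b ⇒⊥ c) d

{-# OPTIONS --safe #-}
-- The operations ∘• and →⊥ are residuated on closed sets: b →⊥ c ⊆ a implies
-- c ⊆ a ∘• b, and conversely each π ∈ a ∘• b lies in the closed set c = cl ｛ π ｝,
-- for which b →⊥ c ⊆ a.  So a ∘• b equals the union even before taking closures.
module Submission where

open import Data.Product using (_×_; _,_; ∃; proj₁; proj₂)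
open import Function using (_∘_)
open import Level using (Level)
open import Relation.Binary.PropositionalEquality using (refl)
open import Relation.Unary using (Pred; _∈_; _⊆_; _≐_; ⋃; ｛_｝)
open import Defs

private
  variable
    ℓ p q : Level

module PolarityProperties (𝒦 : AbstractKrivineStructure ℓ) where
  open AbstractKrivineStructure 𝒦
  open Polarity 𝒦

  cl-extensive : (P : Pred Π p) → P ⊆ cl P
  cl-extensive P π∈P t t∈ = t∈ _ π∈P

  cl-mono : {P : Pred Π p} {Q : Pred Π q} → P ⊆ Q → cl P ⊆ cl Q
  cl-mono P⊆Q π∈ t t∈ = π∈ t (λ ρ ρ∈P → t∈ ρ (P⊆Q ρ∈P))

  cl-least : {P : Pred Π p} (c : 𝒫⊥) → P ⊆ ∣ c ∣ → cl P ⊆ ∣ c ∣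
  cl-least c P⊆c = proj₁ (closed c) ∘ cl-mono P⊆c

  -- Being closed, `c` contains `cl ｛ π ｝` for each of its `π`, so every `t · π′` tested by `∘•` is
  -- a generator of `b →⊥ c`.
  →⊥⊆⇒⊆∘• : (a b c : 𝒫⊥) → (∣ b ∣ →⊥ ∣ c ∣) ⊆ ∣ a ∣ → ∣ c ∣ ⊆ ∣ a ∣ ∘• ∣ b ∣
  →⊥⊆⇒⊆∘• a b c b→c⊆a π∈c t π′ t∈ π′∈ =
    b→c⊆a (cl-extensive _ (t , π′ , t∈ , cl-least c (λ { refl → π∈c }) π′∈ , refl))

  -- Membership of `π` in `a ∘• b` says exactly that the generators lie in `a`; closedness of `a`
  -- extends this to their closure.
  ∘•⇒→⊥-singleton⊆ : (a b : 𝒫⊥) {π : Π} → π ∈ ∣ a ∣ ∘• ∣ b ∣ →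
                     (∣ b ∣ →⊥ cl ｛ π ｝) ⊆ ∣ a ∣
  ∘•⇒→⊥-singleton⊆ a b π∈ = cl-least a λ { (t , π′ , t∈ , π′∈ , refl) → π∈ t π′ t∈ π′∈ }

  ∘•≐⋃ : (a b : 𝒫⊥) →
         ∣ a ∣ ∘• ∣ b ∣ ≐ ⋃[ c ∶ (∃ λ (c : 𝒫⊥) → (∣ b ∣ →⊥ ∣ c ∣) ⊆ ∣ a ∣) ] ∣ proj₁ c ∣
  ∘•≐⋃ a b =
      (λ π∈ → (Cl ｛ _ ｝ , ∘•⇒→⊥-singleton⊆ a b π∈) , cl-extensive _ refl)
    , (λ { ((c , b→c⊆a) , π∈c) → →⊥⊆⇒⊆∘• a b c b→c⊆a π∈c })

  -- Unlike the union, `a ∘• b` stays at level `ℓ`, so its closure is an element of `𝒫⊥`. As `≤` is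
  -- reverse inclusion, the infimum is the least closed set containing every such `c`.
  Cl-∘•-is-♯ : (a b : 𝒫⊥) → Cl (∣ a ∣ ∘• ∣ b ∣) Is a ♯ b
  Cl-∘•-is-♯ a b =
      (λ c b→c⊆a π∈c → cl-extensive _ (→⊥⊆⇒⊆∘• a b c b→c⊆a π∈c))
    , (λ z z≤ → cl-least z
        -- The lower bound `z` contains `cl ｛ π ｝`, hence `π` itself.
        (λ π∈ → z≤ (Cl ｛ _ ｝) (∘•⇒→⊥-singleton⊆ a b π∈) (cl-extensive _ refl)))

mainTheorem8 : ∀ {ℓ} (𝒦 : AbstractKrivineStructure ℓ) → let open Polarity 𝒦 in
    (a b : 𝒫⊥) →
    (cl (∣ a ∣ ∘• ∣ b ∣) ≐ cl (⋃[ c ∶ (∃ λ (c : 𝒫⊥) → (∣ b ∣ →⊥ ∣ c ∣) ⊆ ∣ a ∣) ] ∣ proj₁ c ∣))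
    × (Cl (∣ a ∣ ∘• ∣ b ∣) Is a ♯ b)
mainTheorem8 𝒦 a b =
    (cl-mono (proj₁ (∘•≐⋃ a b)) , cl-mono (proj₂ (∘•≐⋃ a b)))
  , Cl-∘•-is-♯ a b
  where open PolarityProperties 𝒦
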